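{- Let $\beta\ge 2$ be a fixed integer. There are constants $c_1,c_2>0$ depending only on $\beta$ such that in the $1:\beta$ PathWalker-Breaker game played on the complete graph $K_n$, under optimal play by both players, PathWalker visits all but $s$ vertices, where $c_1\log n\le s\le c_2\log n$.
   Context: The $1:\beta$ PathWalker-Breaker game on a graph $G$: two players, (Path)Walker and Breaker, alternate turns. Walker is positioned at a vertex of $G$ (her initial vertex counts as visited). On her turn she moves from her current vertex $v$ along an edge $e=vw$ of $G$ that has not been acquired by Breaker and such that $w$ has not previously been visited by her; she thereby acquires $e$ and visits $w$. On his turn Breaker acquires $\beta$ edges of $G$ not already acquired by either player. The game ends when there is no path from Walker's current position to an unvisited vertex using only edges not acquired by Breaker and (apart from the current position) only previously unvisited vertices. Walker wants to maximize, and Breaker to minimize, the number of vertices Walker visits. The paper states the hypothesis as $1<\beta=O(1)$, i.e. $\beta$ is a constant independent of $n$.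
   Formalization: The bounds are proved for all n at least some N depending only on β, since for n = 2 Walker, moving first, visits both vertices and s = 0 < c₁ log 2; the logarithm is taken as the floor of log base 2. -}

module Defs where

open import Data.Nat using (ℕ; _≤_; _<_)
open import Data.Fin using (Fin)
open import Data.Product using (_×_; _,_; proj₁; proj₂)
open import Data.Sum using (_⊎_)
open import Data.Empty using (⊥)
open import Data.List using (List; []; _∷_; length; _++_)
open import Data.List.Relation.Unary.Any using (Any)
open import Data.List.Relation.Unary.All using (All)
open import Data.List.Relation.Unary.AllPairs using (AllPairs)
open import Data.List.Membership.Propositional using (_∈_; _∉_)
open import Relation.Nullary using (¬_)
open import Relation.Binary.PropositionalEquality using (_≡_; _≢_)

-- Edges of K_n are represented by ordered pairs of vertices, compared
-- as unordered pairs via SameEdge.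
Edge : ℕ → Set
Edge n = Fin n × Fin n

SameEdge : ∀ {n} → Edge n → Edge n → Set
SameEdge (a , b) (c , d) = (a ≡ c × b ≡ d) ⊎ (a ≡ d × b ≡ c)

IsEdge : ∀ {n} → Edge n → Set
IsEdge (a , b) = a ≢ b

InB : ∀ {n} → List (Edge n) → Edge n → Set
InB B e = Any (SameEdge e) B

-- Walker's walk is stored reversed: head = current vertex; the list
-- is exactly the set of visited vertices.  Walker's acquired edges are
-- the consecutive pairs of this list.
InW : ∀ {n} → List (Fin n) → Edge n → Set
InW (x ∷ y ∷ r) e = SameEdge e (x , y) ⊎ InW (y ∷ r) e
InW _ e = ⊥

Free : ∀ {n} → List (Edge n) → List (Fin n) → Edge n → Set
Free B p e = IsEdge e × ¬ InB B e × ¬ InW p e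

data EscPath {n} (B : List (Edge n)) (p : List (Fin n)) : Fin n → Set where
  last : ∀ {v w} → v ≢ w → ¬ InB B (v , w) → w ∉ p → EscPath B p v
  cons : ∀ {v w} → v ≢ w → ¬ InB B (v , w) → w ∉ p → EscPath B p w → EscPath B p v

Over : ∀ {n} → List (Edge n) → Fin n → List (Fin n) → Set
Over B c r = ¬ EscPath B (c ∷ r) c

WalkerLegal : ∀ {n} → List (Edge n) → Fin n → List (Fin n) → Fin n → Set
WalkerLegal B c r w = ¬ InB B (c , w) × w ∉ (c ∷ r)

BreakerLegal : ∀ {n} → ℕ → List (Edge n) → List (Fin n) → List (Edge n) → Set
BreakerLegal β B p L =
  All (Free B p) L × AllPairs (λ e f → ¬ SameEdge e f) L ×
  (length L ≡ β ⊎ (length L < β × (∀ e → Free B p e → Any (SameEdge e) L)))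

-- Walker can force at least k visited vertices.
-- WW: Walker to move; WB: Breaker to move.  (Inductive = finite game tree.)
mutual
  data WW {n} (β k : ℕ) (B : List (Edge n)) (c : Fin n) (r : List (Fin n)) : Set where
    end  : Over B c r → k ≤ length (c ∷ r) → WW β k B c r
    move : ¬ Over B c r → (w : Fin n) → WalkerLegal B c r w → WB β k B w (c ∷ r) → WW β k B c r

  data WB {n} (β k : ℕ) (B : List (Edge n)) (c : Fin n) (r : List (Fin n)) : Set where
    end  : Over B c r → k ≤ length (c ∷ r) → WB β k B c r
    move : ¬ Over B c r →
           (∀ L → BreakerLegal β B (c ∷ r) L → WW β k (L ++ B) c r) → WB β k B c r

-- Breaker can force at most k visited vertices.
-- BW: Walker to move; BB: Breaker to move.
mutual
  data BW {n} (β k : ℕ) (B : List (Edge n)) (c : Fin n) (r : List (Fin n)) : Set where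
    end  : Over B c r → length (c ∷ r) ≤ k → BW β k B c r
    move : ¬ Over B c r →
           (∀ w → WalkerLegal B c r w → BB β k B w (c ∷ r)) → BW β k B c r

  data BB {n} (β k : ℕ) (B : List (Edge n)) (c : Fin n) (r : List (Fin n)) : Set where
    end  : Over B c r → length (c ∷ r) ≤ k → BB β k B c r
    move : ¬ Over B c r → (L : List (Edge n)) → BreakerLegal β B (c ∷ r) L →
           BW β k (L ++ B) c r → BB β k B c r

GameValue : (β n : ℕ) → Fin n → ℕ → Set
GameValue β n v0 k = WW β k [] v0 [] × BW β k [] v0 []

module Submission where

-- The game tree is finite, so every position has a value.
--
-- Breaker keeps a set D of unvisited vertices to which he owns all edges from every
-- vertex that Walker can still reach.  To enlarge D he picks a candidate d; each turn he
-- takes the edge from Walker's position to d, if he does not own it yet, and spends what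
-- is left on other edges at d.  With at least two edges per turn, d is closed off while
-- Walker uses up only half of the reachable vertices, so D reaches size about log₂ n.
--
-- For Walker let U be the set of unvisited vertices she still aims for, S the sum of the
-- Breaker degrees inside U and d(x) the Breaker degree of x into U.  At position c her
-- potential is 2 S + d(c).  A move to w lowers it by d(c) + 3 d(w) and β Breaker edges
-- raise it by at most 6 β, so visiting vertices of about average degree keeps it below
-- 24 β |U|.  While |U| is about 32 θ she writes off the vertices of degree at least θ,
-- each of which costs potential 4 θ; hence she writes off O(β) vertices each time |U|
-- halves, and only O(β) vertices are left when the last phase ends.

open import Defs
open import Data.Nat hiding (_≟_)
open import Data.Nat.Properties renaming (_≟_ to _≡?_)
open import Data.Nat.Logarithm using (⌊log₂_⌋; ⌊log₂⌋-mono-≤; ⌊log₂⌊n/2⌋⌋≡⌊log₂n⌋∸1; ⌊log₂[2^n]⌋≡n)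
open import Data.Nat.Induction using (<-rec)
open import Data.Nat.ListAction using (sum)
open import Data.Nat.ListAction.Properties using (sum-↭)
open import Data.Nat.Tactic.RingSolver using (solve-∀)
open import Data.Fin using (Fin; _≟_)
import Data.Fin.Properties as Fin
open import Data.Product using (∃; ∃₂; ∃-syntax; _×_; _,_; proj₁; proj₂)
open import Data.Sum using (_⊎_; inj₁; inj₂; [_,_]′; map₂)
open import Data.Empty using (⊥; ⊥-elim)
open import Data.Bool using (if_then_else_)
open import Data.List using (List; []; _∷_; length; _++_; map; allFin; cartesianProduct; cartesianProductWith)
open import Data.List.Properties using (length-map; length-++; length-tabulate; map-cong; ++-assoc)
open import Data.List.Relation.Unary.Any using (Any; here; there; any?)
open import Data.List.Relation.Unary.Any.Properties using () renaming (++⁺ˡ to any-++⁺ˡ; ++⁺ʳ to any-++⁺ʳ)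
open import Data.List.Relation.Unary.All using (All; []; _∷_; all?)
import Data.List.Relation.Unary.All as All
open import Data.List.Relation.Unary.All.Properties using (¬Any⇒All¬) renaming (++⁺ to all-++⁺)
open import Data.List.Relation.Unary.AllPairs using (AllPairs; []; _∷_; allPairs?)
open import Data.List.Relation.Unary.Unique.Propositional using (Unique)
open import Data.List.Relation.Unary.Unique.Propositional.Properties using (allFin⁺; Unique[x∷xs]⇒x∉xs)
open import Data.List.Membership.Propositional using (_∈_; _∉_; find; lose)
open import Data.List.Membership.Propositional.Properties
open import Data.List.Relation.Binary.Permutation.Propositional
  using (_↭_; ↭-sym; ↭-trans; ↭-reflexive; ↭-refl; ↭⇒↭ₛ)
open import Data.List.Relation.Binary.Permutation.Propositional.Properties
  using (∈-resp-↭; ↭-length; shift; map⁺) renaming (++⁺ˡ to ↭-++⁺ˡ)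
import Data.List.Relation.Binary.Permutation.Setoid.Properties as Permₛ
open import Relation.Nullary using (¬_; Dec; yes; no; does; contradiction; ¬?; _×-dec_; _⊎-dec_; _→-dec_)
open import Relation.Nullary.Decidable using (map′; dec-true; dec-false)
open import Relation.Unary using (Decidable)
open import Relation.Binary.PropositionalEquality using (_≡_; _≢_; refl; sym; trans; cong; cong₂; subst; setoid; module ≡-Reasoning)
open import Function using (id)

private variable
  n β k l : ℕ
  B : List (Edge n)
  c w : Fin n
  r p A : List (Fin n)

-- Decidability of the rules

SameEdge-refl : (e : Edge n) → SameEdge e e
SameEdge-refl e = inj₁ (refl , refl)

sameEdge? : (e f : Edge n) → Dec (SameEdge e f)
sameEdge? (a , b) (c , d) = ((a ≟ c) ×-dec (b ≟ d)) ⊎-dec ((a ≟ d) ×-dec (b ≟ c))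

inB? : (B : List (Edge n)) (e : Edge n) → Dec (InB B e)
inB? B e = any? (sameEdge? e) B

inW? : (p : List (Fin n)) (e : Edge n) → Dec (InW p e)
inW? []          e = no λ ()
inW? (x ∷ [])    e = no λ ()
inW? (x ∷ y ∷ r) e = sameEdge? e (x , y) ⊎-dec inW? (y ∷ r) e

free? : (B : List (Edge n)) (p : List (Fin n)) (e : Edge n) → Dec (Free B p e)
free? B p e@(a , b) = ¬? (a ≟ b) ×-dec ¬? (inB? B e) ×-dec ¬? (inW? p e)

_∈?_ : (x : Fin n) (xs : List (Fin n)) → Dec (x ∈ xs)
x ∈? xs = any? (x ≟_) xs

walkerLegal? : (B : List (Edge n)) (c : Fin n) (r : List (Fin n)) → Decidable (WalkerLegal B c r)
walkerLegal? B c r w = ¬? (inB? B (c , w)) ×-dec ¬? (w ∈? (c ∷ r))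

allEdges : ∀ n → List (Edge n)
allEdges n = cartesianProduct (allFin n) (allFin n)

∈-allEdges : (e : Edge n) → e ∈ allEdges n
∈-allEdges (a , b) = ∈-cartesianProduct⁺ (∈-allFin a) (∈-allFin b)

breakerLegal? : ∀ β (B : List (Edge n)) p → Decidable (BreakerLegal β B p)
breakerLegal? {n} β B p L =
  all? (free? B p) L ×-dec allPairs? (λ e f → ¬? (sameEdge? e f)) L ×-dec
  ((length L ≡? β) ⊎-dec ((length L <? β) ×-dec
    map′ (λ h e → All.lookup h (∈-allEdges e)) (λ h → All.tabulate λ {e} _ → h e)
      (all? (λ e → free? B p e →-dec any? (sameEdge? e) L) (allEdges n))))

legal⇒¬over : WalkerLegal B c r w → ¬ Over B c r
legal⇒¬over (free , w∉) over = over (last (λ eq → w∉ (here (sym eq))) free w∉)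

stuck⇒over : ¬ ∃ (WalkerLegal B c r) → Over B c r
stuck⇒over stuck (last _ free w∉)   = stuck (_ , free , w∉)
stuck⇒over stuck (cons _ free w∉ _) = stuck (_ , free , w∉)

-- The first edge of an escape path is already a legal move, and a legal move is an escape path of
-- one edge. So the end of the game is the absence of legal moves, decided by finite search.
over-or-move : ∀ (B : List (Edge n)) c r → Over B c r ⊎ ∃ (WalkerLegal B c r)
over-or-move B c r with Fin.any? (walkerLegal? B c r)
... | yes m = inj₂ m
... | no ¬m = inj₁ (stuck⇒over ¬m)

-- Visited and unvisited vertices

-- One permutation encodes both that `A` is the complement of `p` and that neither list has
-- repetitions.
record Unvisited {n} (p A : List (Fin n)) : Set where
  constructor unvisited
  field partition : p ++ A ↭ allFin n

open Unvisited

extract : ∀ {x : Fin n} {xs} → x ∈ xs → ∃ λ ys → xs ↭ x ∷ ys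
extract x∈xs with ys , zs , refl ← ∈-∃++ x∈xs = ys ++ zs , shift _ ys zs

allFin-unique : ∀ {xs} → xs ↭ allFin n → Unique xs
allFin-unique {n} π = Permₛ.Unique-resp-↭ (setoid (Fin n)) (↭⇒↭ₛ (↭-sym π)) (allFin⁺ n)

unique-++ : ∀ {x : Fin n} xs {ys} → Unique (xs ++ ys) → x ∈ xs → x ∉ ys
unique-++ (x ∷ xs) (u ∷ us) (here refl) x∈ys = All.lookup u (∈-++⁺ʳ xs x∈ys) refl
unique-++ (x ∷ xs) (u ∷ us) (there x∈) x∈ys = unique-++ xs us x∈ x∈ys

unvisited-∉ : ∀ {x} → Unvisited {n} p A → x ∈ A → x ∉ p
unvisited-∉ {p = p} π x∈A x∈p = unique-++ p (allFin-unique (partition π)) x∈p x∈A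

∉⇒unvisited : ∀ {x} → Unvisited {n} p A → x ∉ p → x ∈ A
∉⇒unvisited {p = p} {x = x} π x∉p with ∈-++⁻ p (∈-resp-↭ (↭-sym (partition π)) (∈-allFin x))
... | inj₁ x∈p = contradiction x∈p x∉p
... | inj₂ x∈A = x∈A

unvisited-↭ : ∀ {A′} → A ↭ A′ → Unvisited {n} p A → Unvisited p A′
unvisited-↭ {p = p} σ (unvisited π) = unvisited (↭-trans (↭-++⁺ˡ p (↭-sym σ)) π)

unvisited-∷ : ∀ {A′} → Unvisited {n} p A → A ↭ w ∷ A′ → Unvisited (w ∷ p) A′
unvisited-∷ {p = p} π σ = unvisited (↭-trans (↭-sym (shift _ p _)) (partition (unvisited-↭ σ π)))

unvisited-length : Unvisited {n} p A → length p + length A ≡ n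
unvisited-length {p = p} (unvisited π) = trans (sym (length-++ p)) (trans (↭-length π) (length-tabulate id))

visit : WalkerLegal B c r w → Unvisited (c ∷ r) A → ∃ λ A′ → A ↭ w ∷ A′ × Unvisited (w ∷ c ∷ r) A′
visit (_ , w∉) π with A′ , σ ← extract (∉⇒unvisited π w∉) = A′ , σ , unvisited-∷ π σ

-- Legal Breaker moves containing prescribed edges

module _ (B : List (Edge n)) (p : List (Fin n)) where

  Covers : List (Edge n) → List (Edge n) → Set
  Covers L es = ∀ {e} → e ∈ es → Free B p e → Any (SameEdge e) L

  PairwiseDistinct : List (Edge n) → Set
  PairwiseDistinct = AllPairs (λ e f → ¬ SameEdge e f)

  insert : ∀ e L → All (Free B p) L → PairwiseDistinct L →
    ∃ λ L′ → All (Free B p) L′ × PairwiseDistinct L′ × length L′ ≤ suc (length L) ×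
      (Free B p e → Any (SameEdge e) L′) × (∀ {f} → Any (SameEdge f) L → Any (SameEdge f) L′)
  insert e L frees dist with free? B p e | any? (sameEdge? e) L
  ... | no ¬free | _      = L , frees , dist , n≤1+n _ , (λ f → contradiction f ¬free) , id
  ... | yes _    | yes e∈ = L , frees , dist , n≤1+n _ , (λ _ → e∈) , id
  ... | yes free | no e∉  =
    e ∷ L , free ∷ frees , ¬Any⇒All¬ L e∉ ∷ dist , ≤-refl , (λ _ → here (SameEdge-refl e)) , there

  cover : ∀ es → ∃ λ L → All (Free B p) L × PairwiseDistinct L × length L ≤ length es × Covers L es
  cover [] = [] , [] , [] , z≤n , λ ()
  cover (e ∷ es) with L , frees , dist , len , cov ← cover es
    with L′ , frees′ , dist′ , len′ , e∈ , grow ← insert e L frees dist =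
    L′ , frees′ , dist′ , ≤-trans len′ (s≤s len) ,
      λ { (here refl) free → e∈ free ; (there i) free → grow (cov i free) }

  -- Greedy pass over `es`: if it ends short of `β` edges, no free edge of `es` is left out. For
  -- `es = allEdges n` this is the second alternative of `BreakerLegal`.
  fill : ∀ β es L → All (Free B p) L → PairwiseDistinct L → length L ≤ β →
    ∃ λ L′ → All (Free B p) L′ × PairwiseDistinct L′ ×
      (length L′ ≡ β ⊎ (length L′ < β × Covers L′ es)) ×
      (∀ {f} → Any (SameEdge f) L → Any (SameEdge f) L′)
  fill β es L frees dist len with m≤n⇒m<n∨m≡n len
  ... | inj₂ full = L , frees , dist , inj₁ full , id
  fill β [] L frees dist len | inj₁ lt = L , frees , dist , inj₂ (lt , λ ()) , id
  fill β (e ∷ es) L frees dist len | inj₁ lt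
    with L₁ , frees₁ , dist₁ , len₁ , e∈ , grow₁ ← insert e L frees dist
    with fill β es L₁ frees₁ dist₁ (≤-trans len₁ lt)
  ... | L₂ , frees₂ , dist₂ , inj₁ full , grow₂ =
    L₂ , frees₂ , dist₂ , inj₁ full , λ i → grow₂ (grow₁ i)
  ... | L₂ , frees₂ , dist₂ , inj₂ (lt₂ , cov) , grow₂ =
    L₂ , frees₂ , dist₂ ,
    inj₂ (lt₂ , λ { (here refl) free → grow₂ (e∈ free) ; (there i) free → cov i free }) ,
    λ i → grow₂ (grow₁ i)

  -- `Covers` concerns free edges only, so the wish list `es` may contain repetitions and edges
  -- already owned; padding by `fill` makes the move legal.
  claim : ∀ es → length es ≤ β → ∃ λ L → BreakerLegal β B p L × Covers L es
  claim {β} es len with L , frees , dist , len′ , cov ← cover es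
    with fill β (allEdges n) L frees dist (≤-trans len′ len)
  ... | L′ , frees′ , dist′ , inj₁ full , grow =
    L′ , (frees′ , dist′ , inj₁ full) , λ i free → grow (cov i free)
  ... | L′ , frees′ , dist′ , inj₂ (lt , all) , grow =
    L′ , (frees′ , dist′ , inj₂ (lt , λ e → all (∈-allEdges e))) , λ i free → grow (cov i free)

-- Determinacy

mutual
  WW-anti : l ≤ k → WW β k B c r → WW β l B c r
  WW-anti l≤k (end over k≤)     = end over (≤-trans l≤k k≤)
  WW-anti l≤k (move ¬o w leg t) = move ¬o w leg (WB-anti l≤k t)

  WB-anti : l ≤ k → WB β k B c r → WB β l B c r
  WB-anti l≤k (end over k≤) = end over (≤-trans l≤k k≤)
  WB-anti l≤k (move ¬o t)   = move ¬o λ L leg → WW-anti l≤k (t L leg)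

mutual
  BW-mono : k ≤ l → BW β k B c r → BW β l B c r
  BW-mono k≤l (end over ≤k) = end over (≤-trans ≤k k≤l)
  BW-mono k≤l (move ¬o t)   = move ¬o λ w leg → BB-mono k≤l (t w leg)

  BB-mono : k ≤ l → BB β k B c r → BB β l B c r
  BB-mono k≤l (end over ≤k)     = end over (≤-trans ≤k k≤l)
  BB-mono k≤l (move ¬o L leg t) = move ¬o L leg (BW-mono k≤l t)

mutual
  -- Playing the two strategies against each other reaches a single final position, whose number of
  -- visited vertices lies between `k` and `l`.
  WW≤BW : WW β k B c r → BW β l B c r → k ≤ l
  WW≤BW (end _ k≤)       (end _ ≤l)  = ≤-trans k≤ ≤l
  WW≤BW (end over _)     (move ¬o _) = contradiction over ¬o
  WW≤BW (move ¬o _ _ _)  (end over _) = contradiction over ¬o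
  WW≤BW (move _ w leg t) (move _ u)  = WB≤BB t (u w leg)

  WB≤BB : WB β k B c r → BB β l B c r → k ≤ l
  WB≤BB (end _ k≤)   (end _ ≤l)       = ≤-trans k≤ ≤l
  WB≤BB (end over _) (move ¬o _ _ _)  = contradiction over ¬o
  WB≤BB (move ¬o _)  (end over _)     = contradiction over ¬o
  WB≤BB (move _ t)   (move _ L leg u) = WW≤BW (t L leg) u

-- One minimax step: `P` is what the mover secures by choosing `x`, `Q` what the opponent secures
-- against it. The order is `≤` for Walker and `≥` for Breaker.
best : {X : Set} {Legal : X → Set} {P Q : X → ℕ → Set} {_≼_ : ℕ → ℕ → Set} →
  (∀ i j → i ≼ j ⊎ j ≼ i) → (∀ {x i j} → i ≼ j → Q x i → Q x j) → Decidable Legal →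
  (∀ x → Legal x → ∃ λ i → P x i × Q x i) → ∀ xs →
  (∀ {x} → x ∈ xs → ¬ Legal x) ⊎
  (∃₂ λ x i → Legal x × P x i × (∀ {y} → y ∈ xs → Legal y → Q y i))
best total up legal? val [] = inj₁ λ ()
best total up legal? val (x ∷ xs) with legal? x | best total up legal? val xs
... | no ¬lx | inj₁ none = inj₁ λ { (here refl) → ¬lx ; (there y∈) → none y∈ }
... | no ¬lx | inj₂ (y , i , ly , pyi , q) =
  inj₂ (y , i , ly , pyi , λ { (here refl) lx → contradiction lx ¬lx ; (there z∈) → q z∈ })
... | yes lx | inj₁ none with i , pxi , qxi ← val x lx =
  inj₂ (x , i , lx , pxi , λ { (here refl) _ → qxi ; (there z∈) lz → contradiction lz (none z∈) })
... | yes lx | inj₂ (y , j , ly , pyj , q) with i , pxi , qxi ← val x lx | total i j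
... | inj₁ i≼j = inj₂ (y , j , ly , pyj , λ { (here refl) _ → up i≼j qxi ; (there z∈) → q z∈ })
... | inj₂ j≼i = inj₂ (x , i , lx , pxi , λ { (here refl) _ → qxi ; (there z∈) lz → up j≼i (q z∈ lz) })

edgeLists : ∀ n → ℕ → List (List (Edge n))
edgeLists n zero    = [] ∷ []
edgeLists n (suc b) = [] ∷ cartesianProductWith _∷_ (allEdges n) (edgeLists n b)

∈-edgeLists : ∀ {b} (L : List (Edge n)) → length L ≤ b → L ∈ edgeLists n b
∈-edgeLists {b = zero}  []      _ = here refl
∈-edgeLists {b = suc b} []      _ = here refl
∈-edgeLists {b = suc b} (e ∷ L) (s≤s len) =
  there (∈-cartesianProductWith⁺ _∷_ (∈-allEdges e) (∈-edgeLists L len))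

breakerLegal-length : ∀ {L} → BreakerLegal β B p L → length L ≤ β
breakerLegal-length (_ , _ , inj₁ eq)       = ≤-reflexive eq
breakerLegal-length (_ , _ , inj₂ (lt , _)) = <⇒≤ lt

mutual
  -- Backward induction on the number of unvisited vertices, which every Walker move lowers.
  valueW : ∀ m → Unvisited (c ∷ r) A → length A ≤ m → ∃ λ k → WW β k B c r × BW β k B c r
  valueW {c = c} {r} {B = B} m π len with over-or-move B c r
  ... | inj₁ over = _ , end over ≤-refl , end over ≤-refl
  valueW zero π len | inj₂ (w , leg) with _ , σ , _ ← visit leg π
    with () ← ≤-trans (≤-reflexive (sym (↭-length σ))) len
  valueW {c = c} {r} {β = β} {B = B} (suc m) π len | inj₂ (w , leg)
    with best {P = λ w i → WB β i B w (c ∷ r)} {Q = λ w i → BB β i B w (c ∷ r)}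
           ≤-total BB-mono (walkerLegal? B c r)
           (λ w leg → let _ , σ , π′ = visit leg π in
             valueB m π′ (≤-pred (≤-trans (≤-reflexive (sym (↭-length σ))) len)))
           (allFin _)
  ... | inj₁ none = contradiction leg (none (∈-allFin w))
  ... | inj₂ (v , i , legv , wb , bb) =
    i , move (legal⇒¬over leg) v legv wb , move (legal⇒¬over leg) (λ u → bb (∈-allFin u))

  valueB : ∀ m → Unvisited (c ∷ r) A → length A ≤ m → ∃ λ k → WB β k B c r × BB β k B c r
  valueB {c = c} {r} {β = β} {B = B} m π len with over-or-move B c r
  ... | inj₁ over = _ , end over ≤-refl , end over ≤-refl
  ... | inj₂ (w , leg)
    with best {P = λ L i → BW β i (L ++ B) c r} {Q = λ L i → WW β i (L ++ B) c r}
           {_≼_ = _≥_} (λ i j → ≤-total j i) WW-anti (breakerLegal? β B (c ∷ r))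
           (λ L legL → let i , ww , bw = valueW m π len in i , bw , ww)
           (edgeLists _ β)
  ... | inj₁ none with L , legL , _ ← claim B (c ∷ r) {β} [] z≤n =
    contradiction legL (none (∈-edgeLists L (breakerLegal-length legL)))
  ... | inj₂ (L , i , legL , bw , ww) =
    i , move (legal⇒¬over leg) (λ L′ leg′ → ww (∈-edgeLists L′ (breakerLegal-length leg′)) leg′) ,
    move (legal⇒¬over leg) L legL bw

-- Breaker's strategy

InW⇒∈ : ∀ {x y} (p : List (Fin n)) → InW p (x , y) → y ∈ p
InW⇒∈ (u ∷ v ∷ p) (inj₁ (inj₁ (_ , refl))) = there (here refl)
InW⇒∈ (u ∷ v ∷ p) (inj₁ (inj₂ (_ , refl))) = here refl
InW⇒∈ (u ∷ v ∷ p) (inj₂ i)                 = there (InW⇒∈ (v ∷ p) i)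

-- Walker's edges join visited vertices, so an edge to an unvisited `y` is Breaker's already or
-- free, and in the latter case `L` covers it.
claimed : ∀ {L es x y} → Covers B p L es → (x , y) ∈ es → x ≢ y → y ∉ p → InB (L ++ B) (x , y)
claimed {B = B} {p = p} {L = L} cov e∈ x≢y y∉p with inB? B (_ , _)
... | yes old = any-++⁺ʳ L old
... | no new  = any-++⁺ˡ (cov e∈ (x≢y , new , λ i → y∉p (InW⇒∈ p i)))

unvisited-≢ : ∀ {x d} {F : List (Fin n)} → Unvisited p (d ∷ F) → x ∈ F → x ≢ d
unvisited-≢ π x∈F refl = unvisited-∉ (unvisited-∷ π ↭-refl) x∈F (here refl)

unvisited-bound : ∀ {s} → Unvisited {n} p A → s ≤ length A → length p ≤ n ∸ s
unvisited-bound {p = p} π s≤ =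
  m+n≤o⇒m≤o∸n (length p) (≤-trans (+-monoʳ-≤ (length p) s≤) (≤-reflexive (unvisited-length π)))

Guarded : List (Edge n) → List (Fin n) → List (Fin n) → Set
Guarded B D xs = ∀ {x y} → x ∈ xs → y ∈ D → InB B (x , y)

guarded-∷ : ∀ {D A A′ : List (Fin n)} → A ↭ w ∷ A′ → Guarded B D A → Guarded B D (w ∷ A′)
guarded-∷ σ g x∈ = g (∈-resp-↭ (↭-sym σ) x∈)

avoid : ∀ {F} → WalkerLegal B c r w → Unvisited (c ∷ r) (F ++ A) → Guarded B F (c ∷ []) →
  ∃ λ A′ → A ↭ w ∷ A′ × Unvisited (w ∷ c ∷ r) (F ++ A′)
avoid {F = F} leg@(free , w∉) π g with ∈-++⁻ F (∉⇒unvisited π w∉)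
... | inj₁ w∈F = contradiction (g (here refl) w∈F) free
... | inj₂ w∈A with A′ , σ ← extract w∈A =
  A′ , σ , unvisited-∷ π (↭-trans (↭-++⁺ˡ F σ) (shift _ F A′))

mutual
  -- Guarding survives every move, so Walker never enters `D` and Breaker may play any legal moves.
  holdW : ∀ m {D s} → Unvisited {n} (c ∷ r) (D ++ A) → length A ≤ m → Guarded B D (c ∷ A) →
    s ≤ length D → BW β (n ∸ s) B c r
  holdW {c = c} {r = r} {A = A} {B = B} m {D} π len g s≤ with over-or-move B c r
  ... | inj₁ over =
    end over (unvisited-bound π (≤-trans s≤ (≤-trans (m≤m+n _ _) (≤-reflexive (sym (length-++ D))))))
  ... | inj₂ (_ , leg₀) = move (legal⇒¬over leg₀) (reply m len)
    where
    reply : ∀ m → length A ≤ m → ∀ w → WalkerLegal B c r w → BB _ _ B w (c ∷ r)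
    reply m len w leg with A′ , σ , π′ ← avoid leg π (λ { (here refl) → g (here refl) })
      with m | ≤-trans (≤-reflexive (sym (↭-length σ))) len
    ... | suc m | s≤s len′ = holdB m π′ len′ (guarded-∷ σ (λ x∈ → g (there x∈))) s≤

  holdB : ∀ m {D s} → Unvisited {n} (c ∷ r) (D ++ A) → length A ≤ m → Guarded B D (c ∷ A) →
    s ≤ length D → BB β (n ∸ s) B c r
  holdB {c = c} {r = r} {B = B} {β = β} m {D} π len g s≤ with over-or-move B c r
  ... | inj₁ over =
    end over (unvisited-bound π (≤-trans s≤ (≤-trans (m≤m+n _ _) (≤-reflexive (sym (length-++ D))))))
  ... | inj₂ (_ , leg₀) with L , legL , _ ← claim B (c ∷ r) {β} [] z≤n =
    move (legal⇒¬over leg₀) L legL (holdW m π len (λ x∈ y∈ → any-++⁺ʳ L (g x∈ y∈)) s≤)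

-- The number of unprotected vertices that suffices to protect j further ones, up to
-- a factor 2: closing off one candidate costs half of them, rounding costs a constant.
reserve : ℕ → ℕ
reserve zero    = 0
reserve (suc j) = 4 + 2 * reserve j

2j≤reserve : ∀ j → 2 * j ≤ reserve j
2j≤reserve zero    = z≤n
2j≤reserve (suc j) = begin
  2 * suc j           ≡⟨ *-suc 2 j ⟩
  2 + 2 * j           ≤⟨ +-mono-≤ {2} {4} (s≤s (s≤s z≤n)) (≤-trans (2j≤reserve j) (m≤m+n (reserve j) _)) ⟩
  4 + 2 * reserve j   ∎
  where open ≤-Reasoning

reserve-bound : ∀ {x a} j → x + reserve j ≤ 2 * a → j ≤ a
reserve-bound j le = *-cancelˡ-≤ 2 (≤-trans (2j≤reserve j) (≤-trans (m≤n+m _ _) le))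

-- Besides `a` vertices, the right side counts Walker's position and the next candidate; the 4 in
-- `reserve` pays for these two. The next candidate starts with up to `a` missing edges.
reserve-next : ∀ {x a} j → x + reserve (suc j) ≤ 2 * suc (suc a) → a + reserve j ≤ 2 * a
reserve-next {x} {a} j le = begin
  a + reserve j       ≤⟨ +-monoʳ-≤ a (*-cancelˡ-≤ 2 (+-cancelˡ-≤ 4 _ _ 4+2h≤4+2a)) ⟩
  a + a               ≡⟨ cong (a +_) (+-identityʳ a) ⟨
  2 * a               ∎
  where
  open ≤-Reasoning
  4+2h≤4+2a : 4 + 2 * reserve j ≤ 4 + 2 * a
  4+2h≤4+2a = ≤-trans (m≤n+m _ x) (≤-trans le (≤-reflexive (trans (*-suc 2 (suc a)) (cong (2 +_) (*-suc 2 a)))))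

-- D is the protected set: every vertex that Walker can still reach is already
-- Breaker-adjacent to all of D.  Breaker is closing off the candidate d; an edge
-- from d to A that he may still be missing ends in X.
record Closing {d : Fin n} {D A : List (Fin n)} (B : List (Edge n)) (c : Fin n) (X : List (Fin n)) (j s : ℕ) : Set where
  field
    guarded : Guarded B D (c ∷ d ∷ A)
    missing : ∀ {x} → x ∈ A → InB B (x , d) ⊎ x ∈ X
    target  : s ≤ length D + j

open Closing

-- If the game ends early, all of `d`, `D` and `A` stay unvisited, which is enough.
closing-bound : ∀ {d D A} {X : List (Fin n)} {j s} → Unvisited {n} p (d ∷ D ++ A) →
  Closing {d = d} {D} {A} B c X j s → j ≤ suc (length A) → length p ≤ n ∸ s
closing-bound {D = D} {A} {j = j} {s} π C j≤ = unvisited-bound π (begin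
  s                           ≤⟨ target C ⟩
  length D + j                ≤⟨ +-monoʳ-≤ (length D) j≤ ⟩
  length D + suc (length A)   ≡⟨ +-suc _ _ ⟩
  suc (length D + length A)   ≡⟨ cong suc (length-++ D) ⟨
  suc (length (D ++ A))       ∎)
  where open ≤-Reasoning

mutual
  -- The budget is invariant: Walker's move removes one vertex of `A`, lowering the right side by 2,
  -- and Breaker's two edges remove two entries of `X`.
  closeW : ∀ m j {d D A X s} → 2 ≤ β → Unvisited {n} (c ∷ r) (d ∷ D ++ A) → length A ≤ m →
    Closing {d = d} {D} {A} B c X j s → InB B (c , d) → length X + reserve j ≤ 2 * length A →
    BW β (n ∸ s) B c r
  closeW {n = n} {c = c} {r = r} {B = B} m j 2≤β π len C cd budget with over-or-move B c r
  ... | inj₁ over = end over (closing-bound π C (m≤n⇒m≤1+n (reserve-bound j budget)))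
  ... | inj₂ (_ , leg₀) = move (legal⇒¬over leg₀) (reply m 2≤β π len C cd budget)
    where
    reply : ∀ m {β d D A X s} → 2 ≤ β → Unvisited {n} (c ∷ r) (d ∷ D ++ A) → length A ≤ m →
      Closing {d = d} {D} {A} B c X j s → InB B (c , d) → length X + reserve j ≤ 2 * length A →
      ∀ w → WalkerLegal B c r w → BB β (n ∸ s) B w (c ∷ r)
    reply m {d = d} {D} {X = X} 2≤β π len C cd budget w leg
      with A′ , σ , π′ ← avoid {F = d ∷ D} leg π
             (λ { (here refl) (here refl) → cd ; (here refl) (there y∈) → guarded C (here refl) y∈ })
      with m | ≤-trans (≤-reflexive (sym (↭-length σ))) len
    ... | suc m | s≤s len′ = continue (missing C (∈-resp-↭ (↭-sym σ) (here refl)))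
      where
      guarded′ : Guarded B D (w ∷ d ∷ A′)
      guarded′ (here refl)         = guarded C (there (there (∈-resp-↭ (↭-sym σ) (here refl))))
      guarded′ (there (here refl)) = guarded C (there (here refl))
      guarded′ (there (there x∈))  = guarded C (there (there (∈-resp-↭ (↭-sym σ) (there x∈))))

      budget′ : ∀ {x} → x ≡ length X → x + reserve j ≤ 2 * suc (length A′)
      budget′ refl = ≤-trans budget (≤-reflexive (cong (2 *_) (↭-length σ)))

      continue : InB B (w , d) ⊎ w ∈ X → BB _ _ B w (c ∷ r)
      continue (inj₁ wd) = closeB m j 2≤β π′ len′
        (record { guarded = guarded′ ; missing = λ x∈ → missing C (∈-resp-↭ (↭-sym σ) (there x∈)) ; target = target C })
        (inj₁ wd) (budget′ refl)
      -- With `w` in front of `X`, Breaker's next claim includes the edge from `w` to `d`.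
      continue (inj₂ w∈X) with X₀ , τ ← extract w∈X = closeB m j 2≤β π′ len′
        (record { guarded = guarded′
                ; missing = λ x∈ → map₂ (∈-resp-↭ τ) (missing C (∈-resp-↭ (↭-sym σ) (there x∈)))
                ; target = target C })
        (inj₂ (X₀ , refl)) (budget′ (sym (↭-length τ)))

  closeB : ∀ m j {d D A X s} → 2 ≤ β → Unvisited {n} (c ∷ r) (d ∷ D ++ A) → length A ≤ m →
    Closing {d = d} {D} {A} B c X j s → InB B (c , d) ⊎ (∃ λ X₀ → X ≡ c ∷ X₀) →
    length X + reserve j ≤ 2 * suc (length A) → BB β (n ∸ s) B c r
  -- `D` has reached its target: `d` becomes an ordinary open vertex again and `D` is only held.
  closeB m zero {d} {D} {A} 2≤β π len C cd budget =
    holdB (suc m) {D} (unvisited-↭ (↭-sym (shift d D A)) π) (s≤s len) (guarded C)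
      (≤-trans (target C) (≤-reflexive (+-identityʳ _)))
  closeB {c = c} {r = r} {B = B} m (suc j) 2≤β π len C cd budget with over-or-move B c r
  ... | inj₁ over = end over (closing-bound π C (reserve-bound (suc j) budget))
  closeB {β = β} {c = c} {r = r} {B = B} m (suc j) {d} {D} {A} {x ∷ y ∷ X} 2≤β π len C cd budget
    | inj₂ (_ , leg₀) with L , legL , cov ← claim B (c ∷ r) {β} ((x , d) ∷ (y , d) ∷ []) 2≤β =
    move (legal⇒¬over leg₀) L legL (closeW m (suc j) 2≤β π len C′ (cd′ cd)
      (+-cancelˡ-≤ 2 _ _ (≤-trans budget (≤-reflexive (*-suc 2 (length A))))))
    where
    d∉ : d ∉ c ∷ r
    d∉ = unvisited-∉ π (here refl)

    C′ : Closing (L ++ B) c X (suc j) _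
    C′ .guarded x∈ y∈ = any-++⁺ʳ L (guarded C x∈ y∈)
    C′ .target = target C
    C′ .missing {z} z∈ with missing C z∈ | unvisited-≢ π (∈-++⁺ʳ D z∈)
    ... | inj₁ zd                  | _   = inj₁ (any-++⁺ʳ L zd)
    ... | inj₂ (here refl)         | z≢d = inj₁ (claimed cov (here refl) z≢d d∉)
    ... | inj₂ (there (here refl)) | z≢d = inj₁ (claimed cov (there (here refl)) z≢d d∉)
    ... | inj₂ (there (there z∈X)) | _   = inj₂ z∈X

    cd′ : InB B (c , d) ⊎ (∃ λ X₀ → x ∷ y ∷ X ≡ c ∷ X₀) → InB (L ++ B) (c , d)
    cd′ (inj₁ cd)         = any-++⁺ʳ L cd
    cd′ (inj₂ (_ , refl)) = claimed cov (here refl) (λ eq → d∉ (here (sym eq))) d∉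
  closeB m (suc j) {X = []}     2≤β π len C cd budget | inj₂ (_ , leg₀) =
    nextB m j 2≤β π len C cd budget z≤n leg₀
  closeB m (suc j) {X = x ∷ []} 2≤β π len C cd budget | inj₂ (_ , leg₀) =
    nextB m j 2≤β π len C cd budget (s≤s z≤n) leg₀

  -- Breaker takes the last missing edge at `d`, if any, and the edge from `c` to a new candidate
  -- `a`. Then `d` joins `D`, and `X` restarts as all of the remaining `A`.
  nextB : ∀ m j {d D A X s} → 2 ≤ β → Unvisited {n} (c ∷ r) (d ∷ D ++ A) → length A ≤ m →
    Closing {d = d} {D} {A} B c X (suc j) s → InB B (c , d) ⊎ (∃ λ X₀ → X ≡ c ∷ X₀) →
    length X + reserve (suc j) ≤ 2 * suc (length A) → length X ≤ 1 →
    WalkerLegal B c r w → BB β (n ∸ s) B c r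
  nextB m j {A = []} {X} 2≤β π len C cd budget X≤1 leg₀
    with s≤s (s≤s ()) ← ≤-trans (m≤n+m (reserve (suc j)) (length X)) budget
  nextB {β = β} {c = c} {r = r} {B = B} m j {d} {D} {a ∷ A} {X} 2≤β π len C cd budget X≤1 leg₀
    with L , legL , cov ← claim B (c ∷ r) {β} ((c , a) ∷ map (_, d) X)
           (≤-trans (s≤s (≤-trans (≤-reflexive (length-map _ X)) X≤1)) 2≤β) =
    move (legal⇒¬over leg₀) L legL
      (closeW m j 2≤β π′ (≤-trans (n≤1+n _) len) C′ ca (reserve-next {length X} j budget))
    where
    π′ : Unvisited (c ∷ r) (a ∷ d ∷ D ++ A)
    π′ = unvisited-↭ (shift a (d ∷ D) A) π

    d∉ : d ∉ c ∷ r
    d∉ = unvisited-∉ π (here refl)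

    a∉ : a ∉ c ∷ r
    a∉ = unvisited-∉ π′ (here refl)

    ca : InB (L ++ B) (c , a)
    ca = claimed cov (here refl) (λ eq → a∉ (here (sym eq))) a∉

    todo : ∀ {x} → x ∈ X → x ≢ d → InB (L ++ B) (x , d)
    todo x∈X x≢d = claimed cov (there (∈-map⁺ (_, d) x∈X)) x≢d d∉

    closed : ∀ {x} → x ∈ c ∷ a ∷ A → InB (L ++ B) (x , d)
    closed (here refl) = [ any-++⁺ʳ L
      , (λ (_ , eq) → todo (subst (c ∈_) (sym eq) (here refl)) (λ c≡d → d∉ (here (sym c≡d)))) ]′ cd
    closed (there x∈) with missing C x∈
    ... | inj₁ xd  = any-++⁺ʳ L xd
    ... | inj₂ x∈X = todo x∈X (unvisited-≢ π (∈-++⁺ʳ D x∈))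

    C′ : Closing {D = d ∷ D} (L ++ B) c A j _
    C′ .guarded x∈ (here refl) = closed x∈
    C′ .guarded (here refl) (there y∈) = any-++⁺ʳ L (guarded C (here refl) y∈)
    C′ .guarded (there x∈)  (there y∈) = any-++⁺ʳ L (guarded C (there (there x∈)) y∈)
    C′ .missing x∈ = inj₂ x∈
    C′ .target = ≤-trans (target C) (≤-reflexive (+-suc _ _))

unvisited-start : (v : Fin n) → ∃ λ A → Unvisited (v ∷ []) A
unvisited-start v with A , σ ← extract (∈-allFin v) = A , unvisited (↭-sym σ)

-- After Walker's first move `D` is empty and every edge to the first candidate counts as missing;
-- `3 ≤ n` provides that candidate.
breaker-bound : ∀ j → 2 ≤ β → 3 ≤ n → 2 + reserve j ≤ n → (v : Fin n) → BW β (n ∸ j) [] v []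
breaker-bound {β} {n} j 2≤β 3≤n j≤ v with over-or-move [] v []
... | inj₁ over = end over (m+n≤o⇒m≤o∸n 1
  (≤-trans (s≤s (m≤n⇒m≤1+n (≤-trans (m≤n*m j 2) (2j≤reserve j)))) j≤))
... | inj₂ (_ , leg₀) = move (legal⇒¬over leg₀) reply
  where
  reply : ∀ w → WalkerLegal [] v [] w → BB β (n ∸ j) [] w (v ∷ [])
  reply w leg with visit leg (proj₂ (unvisited-start v))
  ... | [] , σ , π 
    with s≤s (s≤s ()) ← ≤-trans 3≤n (≤-reflexive (sym (unvisited-length π)))
  ... | d ∷ A , σ , π = closeB (length A) j {D = []} {X = w ∷ A} 2≤β π ≤-refl
    (record { guarded = λ _ () ; missing = λ x∈ → inj₂ (there x∈) ; target = ≤-refl })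
    (inj₂ (A , refl)) (begin
      suc (length A) + reserve j             ≤⟨ +-monoʳ-≤ (suc (length A)) reserve≤ ⟩
      suc (length A) + suc (length A)        ≡⟨ cong (suc (length A) +_) (+-identityʳ _) ⟨
      2 * suc (length A)                     ∎)
    where
    open ≤-Reasoning
    reserve≤ : reserve j ≤ suc (length A)
    reserve≤ = +-cancelˡ-≤ 2 _ _ (≤-trans j≤ (≤-reflexive (sym (unvisited-length π))))

-- Counting Breaker's edges

sum-map-+ : {X : Set} (f g : X → ℕ) (xs : List X) →
  sum (map (λ x → f x + g x) xs) ≡ sum (map f xs) + sum (map g xs)
sum-map-+ f g []       = refl
sum-map-+ f g (x ∷ xs) = trans (cong (f x + g x +_) (sum-map-+ f g xs)) (shuffle (f x) (g x) _ _)
  where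
  shuffle : ∀ a b s t → (a + b) + (s + t) ≡ (a + s) + (b + t)
  shuffle = solve-∀

sum-map-* : {X : Set} (k : ℕ) (f : X → ℕ) (xs : List X) → sum (map (λ x → k * f x) xs) ≡ k * sum (map f xs)
sum-map-* k f []       = sym (*-zeroʳ k)
sum-map-* k f (x ∷ xs) = trans (cong (k * f x +_) (sum-map-* k f xs)) (sym (*-distribˡ-+ k (f x) _))

sum-map-≤ : {X : Set} (f g : X → ℕ) (xs : List X) → (∀ {x} → x ∈ xs → f x ≤ g x) →
  sum (map f xs) ≤ sum (map g xs)
sum-map-≤ f g []       f≤g = z≤n
sum-map-≤ f g (x ∷ xs) f≤g = +-mono-≤ (f≤g (here refl)) (sum-map-≤ f g xs (λ x∈ → f≤g (there x∈)))

sum-map-const : {X : Set} (k : ℕ) (xs : List X) → sum (map (λ _ → k) xs) ≡ length xs * k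
sum-map-const k []       = refl
sum-map-const k (x ∷ xs) = cong (k +_) (sum-map-const k xs)

-- Pigeonhole. Applied to the multiplicities of Breaker's edges at a vertex, it finds a vertex to
-- which Breaker owns no edge from there.
find-zero : {X : Set} (f : X → ℕ) (xs : List X) → sum (map f xs) < length xs → ∃ λ x → x ∈ xs × f x ≡ 0
find-zero f (x ∷ xs) lt with f x in eq
... | zero  = x , here refl , eq
... | suc m with y , y∈ , fy ← find-zero f xs (≤-trans (s≤s (m≤n+m _ m)) (≤-pred lt)) = y , there y∈ , fy

deg : {V : Set} → (V → V → ℕ) → List V → V → ℕ
deg a U x = sum (map (a x) U)

-- For symmetric loopless `a` this is twice the number of edges inside `U`, with multiplicity.
degSum : {V : Set} → (V → V → ℕ) → List V → ℕ
degSum a U = sum (map (deg a U) U)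

module _ {V : Set} (a : V → V → ℕ) where

  deg-↭ : ∀ {U U′} x → U ↭ U′ → deg a U x ≡ deg a U′ x
  deg-↭ x σ = sum-↭ (map⁺ (a x) σ)

  degSum-↭ : ∀ {U U′} → U ↭ U′ → degSum a U ≡ degSum a U′
  degSum-↭ {U} {U′} σ = trans (sum-↭ (map⁺ (deg a U) σ)) (cong sum (map-cong (λ x → deg-↭ x σ) U′))

  module _ (a-sym : ∀ x y → a x y ≡ a y x) (a-irrefl : ∀ x → a x x ≡ 0) where

    deg-self : ∀ {U U′ x} → U ↭ x ∷ U′ → deg a U x ≡ deg a U′ x
    deg-self {U′ = U′} {x} σ = trans (deg-↭ x σ) (cong (_+ deg a U′ x) (a-irrefl x))

    -- Edges at `x` are counted once in the row of `x` and once in the rows of its neighbours.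
    degSum-remove : ∀ {U U′ x} → U ↭ x ∷ U′ → degSum a U ≡ 2 * deg a U′ x + degSum a U′
    degSum-remove {U} {U′} {x} σ = begin
      degSum a U
        ≡⟨ degSum-↭ σ ⟩
      a x x + deg a U′ x + sum (map (λ y → a y x + deg a U′ y) U′)
        ≡⟨ cong₂ _+_ (cong (_+ deg a U′ x) (a-irrefl x)) (sum-map-+ (λ y → a y x) (deg a U′) U′) ⟩
      deg a U′ x + (sum (map (λ y → a y x) U′) + degSum a U′)
        ≡⟨ cong (λ t → deg a U′ x + (t + degSum a U′)) (cong sum (map-cong (λ y → a-sym y x) U′)) ⟩
      deg a U′ x + (deg a U′ x + degSum a U′)
        ≡⟨ double (deg a U′ x) (degSum a U′) ⟩
      2 * deg a U′ x + degSum a U′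
        ∎
      where
      open ≡-Reasoning
      double : ∀ d t → d + (d + t) ≡ 2 * d + t
      double = solve-∀

-- Multiplicities of Breaker's edges

δ : Fin n → Fin n → ℕ
δ x y = if does (x ≟ y) then 1 else 0

δ-refl : (x : Fin n) → δ x x ≡ 1
δ-refl x = cong (if_then 1 else 0) (dec-true (x ≟ x) refl)

δ-≢ : {x y : Fin n} → x ≢ y → δ x y ≡ 0
δ-≢ {x = x} {y} x≢y = cong (if_then 1 else 0) (dec-false (x ≟ y) x≢y)

count : Fin n → List (Fin n) → ℕ
count p U = sum (map (λ x → δ x p) U)

count-∉ : ∀ {p : Fin n} U → p ∉ U → count p U ≡ 0
count-∉ []      p∉ = refl
count-∉ (x ∷ U) p∉ = cong₂ _+_ (δ-≢ (λ eq → p∉ (here (sym eq)))) (count-∉ U (λ i → p∉ (there i)))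

count-≤1 : ∀ (p : Fin n) {U} → Unique U → count p U ≤ 1
count-≤1 p []               = z≤n
count-≤1 p {x ∷ U} u@(_ ∷ us) with x ≟ p
... | yes refl = ≤-reflexive (cong suc (count-∉ U (Unique[x∷xs]⇒x∉xs u)))
... | no _     = count-≤1 p us

-- Both orientations are counted, so a loop would have multiplicity 2.
link : Edge n → Fin n → Fin n → ℕ
link (p , q) x y = δ x p * δ y q + δ x q * δ y p

mult : List (Edge n) → Fin n → Fin n → ℕ
mult []      x y = 0
mult (e ∷ B) x y = link e x y + mult B x y

mult-sym : ∀ (B : List (Edge n)) x y → mult B x y ≡ mult B y x
mult-sym []            x y = refl
mult-sym ((p , q) ∷ B) x y = cong₂ _+_ (flip (δ x p) (δ y q) (δ x q) (δ y p)) (mult-sym B x y)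
  where
  flip : ∀ a b c d → a * b + c * d ≡ d * c + b * a
  flip = solve-∀

mult-irrefl : ∀ {B : List (Edge n)} → All IsEdge B → ∀ x → mult B x x ≡ 0
mult-irrefl [] x = refl
mult-irrefl {B = (p , q) ∷ B} (p≢q ∷ es) x with x ≟ p | x ≟ q
... | yes refl | yes refl = contradiction refl p≢q
... | yes _    | no _     = mult-irrefl es x
... | no _     | yes _    = mult-irrefl es x
... | no _     | no _     = mult-irrefl es x

InB⇒mult : ∀ {x y} (B : List (Edge n)) → InB B (x , y) → 1 ≤ mult B x y
InB⇒mult {x = x} {y} (_ ∷ B) (here (inj₁ (refl , refl))) =
  ≤-trans (≤-reflexive (sym (cong₂ _*_ (δ-refl x) (δ-refl y)))) (≤-trans (m≤m+n _ _) (m≤m+n _ _))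
InB⇒mult {x = x} {y} (_ ∷ B) (here (inj₂ (refl , refl))) =
  ≤-trans (≤-reflexive (sym (cong₂ _*_ (δ-refl x) (δ-refl y)))) (≤-trans (m≤n+m _ (δ x y * δ y x)) (m≤m+n _ _))
InB⇒mult (e ∷ B) (there i) = ≤-trans (InB⇒mult B i) (m≤n+m _ _)

mult≡0⇒∉B : ∀ {x y} (B : List (Edge n)) → mult B x y ≡ 0 → ¬ InB B (x , y)
mult≡0⇒∉B B eq i = 1+n≰n (≤-trans (InB⇒mult B i) (≤-reflexive eq))

deg-link : ∀ p q (U : List (Fin n)) → Unique U → ∀ x → deg (link (p , q)) U x ≤ δ x p + δ x q
deg-link p q U u x = begin
  deg (link (p , q)) U x
    ≡⟨ sum-map-+ (λ y → δ x p * δ y q) (λ y → δ x q * δ y p) U ⟩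
  sum (map (λ y → δ x p * δ y q) U) + sum (map (λ y → δ x q * δ y p) U)
    ≡⟨ cong₂ _+_ (sum-map-* (δ x p) (λ y → δ y q) U) (sum-map-* (δ x q) (λ y → δ y p) U) ⟩
  δ x p * count q U + δ x q * count p U
    ≤⟨ +-mono-≤ (*-monoʳ-≤ (δ x p) (count-≤1 q u)) (*-monoʳ-≤ (δ x q) (count-≤1 p u)) ⟩
  δ x p * 1 + δ x q * 1
    ≡⟨ cong₂ _+_ (*-identityʳ (δ x p)) (*-identityʳ (δ x q)) ⟩
  δ x p + δ x q ∎
  where open ≤-Reasoning

δ-≤1 : (x y : Fin n) → δ x y ≤ 1
δ-≤1 x y with x ≟ y
... | yes _ = ≤-refl
... | no _  = z≤n

degSum-link : ∀ p q (U : List (Fin n)) → Unique U → degSum (link (p , q)) U ≤ 2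
degSum-link p q U u = begin
  degSum (link (p , q)) U
    ≤⟨ sum-map-≤ (deg (link (p , q)) U) (λ x → δ x p + δ x q) U (λ {x} _ → deg-link p q U u x) ⟩
  sum (map (λ x → δ x p + δ x q) U)
    ≡⟨ sum-map-+ (λ x → δ x p) (λ x → δ x q) U ⟩
  count p U + count q U
    ≤⟨ +-mono-≤ (count-≤1 p u) (count-≤1 q u) ⟩
  2 ∎
  where open ≤-Reasoning

-- A crude 2 per edge, one for each endpoint. With the 2 per edge of `degSum-grow`, the potential
-- `2 S + d` rises by at most 6 per edge.
deg-grow : ∀ (L B : List (Edge n)) {U} → Unique U → ∀ x →
  deg (mult (L ++ B)) U x ≤ 2 * length L + deg (mult B) U x
deg-grow [] B u x = ≤-refl
deg-grow (e@(p , q) ∷ L) B {U} u x = begin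
  deg (mult (e ∷ L ++ B)) U x
    ≡⟨ sum-map-+ (link e x) (mult (L ++ B) x) U ⟩
  deg (link e) U x + deg (mult (L ++ B)) U x
    ≤⟨ +-mono-≤ (≤-trans (deg-link p q U u x) (+-mono-≤ (δ-≤1 x p) (δ-≤1 x q))) (deg-grow L B u x) ⟩
  2 + (2 * length L + deg (mult B) U x)
    ≡⟨ cong (_+ deg (mult B) U x) (*-suc 2 (length L)) ⟨
  2 * suc (length L) + deg (mult B) U x ∎
  where open ≤-Reasoning

degSum-grow : ∀ (L B : List (Edge n)) {U} → Unique U →
  degSum (mult (L ++ B)) U ≤ 2 * length L + degSum (mult B) U
degSum-grow [] B u = ≤-refl
degSum-grow (e@(p , q) ∷ L) B {U} u = begin
  degSum (mult (e ∷ L ++ B)) U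
    ≡⟨ cong sum (map-cong (λ x → sum-map-+ (link e x) (mult (L ++ B) x) U) U) ⟩
  sum (map (λ x → deg (link e) U x + deg (mult (L ++ B)) U x) U)
    ≡⟨ sum-map-+ (deg (link e) U) (deg (mult (L ++ B)) U) U ⟩
  degSum (link e) U + degSum (mult (L ++ B)) U
    ≤⟨ +-mono-≤ (degSum-link p q U u) (degSum-grow L B u) ⟩
  2 + (2 * length L + degSum (mult B) U)
    ≡⟨ cong (_+ degSum (mult B) U) (*-suc 2 (length L)) ⟨
  2 * suc (length L) + degSum (mult B) U ∎
  where open ≤-Reasoning

-- Linear arithmetic: a ≤ b is certified by a combination x ≤ y of hypotheses and the slack z.
linear : ∀ {a b x y} z → x ≤ y → a + y + z ≡ b + x → a ≤ b
linear {a} {b} {x} {y} z x≤y eq = +-cancelʳ-≤ y a b (begin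
  a + y       ≤⟨ m≤m+n (a + y) z ⟩
  a + y + z   ≡⟨ eq ⟩
  b + x       ≤⟨ +-monoʳ-≤ b x≤y ⟩
  b + y       ∎)
  where open ≤-Reasoning

-- Choosing Walker's next vertex

module _ {V : Set} (a : V → V → ℕ) (β θ : ℕ) (U : List V) (c : V) where

  private
    m d S : ℕ
    m = length U
    d = deg a U c
    S = degSum a U

  -- The inequality keeps the potential within `24 β` per vertex after the move to `w` and Breaker's
  -- reply: `30 β` is `24 β` for the vertex leaving `U` plus `6 β` for the new edges.
  Good : V → Set
  Good w = a c w ≡ 0 × 2 * S + d + 30 * β ≤ 24 * β * m + d + 3 * deg a U w

  good? : Decidable Good
  good? w = (a c w ≡? 0) ×-dec (_ ≤? _)

  -- If no free neighbour of c had large degree, then c would have few neighbours in U,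
  -- all of them of degree below θ, so the degree sum over U would be too small.
  choose : 1 ≤ θ → 32 * θ < m → d < m → 2 * S + d ≤ 24 * β * m →
    (∀ {x} → x ∈ U → deg a U x < θ) → ∃ λ w → w ∈ U × Good w
  choose 1≤θ θ<m d<m sparse small with any? good? U
  ... | yes ok = find ok
  ... | no bad = ⊥-elim (contra β θ m S 3S≤ (avg (deg a U (proj₁ stuck)) (proj₁ (proj₂ stuck))) θ<m 1≤θ)
    where
    fails : ∀ {x} → x ∈ U → a c x ≡ 0 → 24 * β * m + d + 3 * deg a U x < 2 * S + d + 30 * β
    fails x∈ free = ≰⇒> (λ le → bad (lose x∈ (free , le)))

    stuck : ∃ λ w → (24 * β * m + d + 3 * deg a U w < 2 * S + d + 30 * β) × w ∈ U
    stuck with w , w∈ , free ← find-zero (a c) U d<m = w , fails w∈ free , w∈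

    avg : ∀ D → 24 * β * m + d + 3 * D < 2 * S + d + 30 * β → 24 * β * m < 2 * S + 30 * β
    avg D h = linear (3 * D) h (eq β m d S D)
      where
      eq : ∀ β m d S D → suc (24 * β * m) + (2 * S + d + 30 * β) + 3 * D ≡ 2 * S + 30 * β + suc (24 * β * m + d + 3 * D)
      eq = solve-∀

    -- Adding `sparse` to the failure at a free vertex of degree `D` leaves `d + 3 D < 30 β`; `few`
    -- and `low` each keep one summand.
    few : ∀ D → 24 * β * m + d + 3 * D < 2 * S + d + 30 * β → d ≤ 30 * β
    few D h = linear (1 + 3 * D) (+-mono-≤ h sparse) (eq β m d S D)
      where
      eq : ∀ β m d S D → d + (2 * S + d + 30 * β + 24 * β * m) + (1 + 3 * D) ≡ 30 * β + (suc (24 * β * m + d + 3 * D) + (2 * S + d))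
      eq = solve-∀

    low : ∀ D → 24 * β * m + d + 3 * D < 2 * S + d + 30 * β → 3 * D ≤ 30 * β
    low D h = linear (1 + d) (+-mono-≤ h sparse) (eq β m d S D)
      where
      eq : ∀ β m d S D → 3 * D + (2 * S + d + 30 * β + 24 * β * m) + (1 + d) ≡ 30 * β + (suc (24 * β * m + d + 3 * D) + (2 * S + d))
      eq = solve-∀

    -- A vertex that is not free has degree below `θ`, charged to its multiplicity `a c x`; these
    -- multiplicities sum to `d`.
    each : ∀ {x} → x ∈ U → 3 * deg a U x ≤ 30 * β + 3 * θ * a c x
    each {x} x∈ with a c x in eq
    ... | zero  = ≤-trans (low (deg a U x) (fails x∈ eq)) (m≤m+n _ _)
    ... | suc k = ≤-trans (*-monoʳ-≤ 3 (<⇒≤ (small x∈))) (≤-trans (m≤m*n (3 * θ) (suc k)) (m≤n+m _ _))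

    3S≤ : 3 * S ≤ m * (30 * β) + 3 * θ * (30 * β)
    3S≤ = begin
      3 * S
        ≡⟨ sum-map-* 3 (deg a U) U ⟨
      sum (map (λ x → 3 * deg a U x) U)
        ≤⟨ sum-map-≤ (λ x → 3 * deg a U x) (λ x → 30 * β + 3 * θ * a c x) U each ⟩
      sum (map (λ x → 30 * β + 3 * θ * a c x) U)
        ≡⟨ sum-map-+ (λ _ → 30 * β) (λ x → 3 * θ * a c x) U ⟩
      sum (map (λ _ → 30 * β) U) + sum (map (λ x → 3 * θ * a c x) U)
        ≡⟨ cong₂ _+_ (sum-map-const (30 * β) U) (sum-map-* (3 * θ) (a c) U) ⟩
      m * (30 * β) + 3 * θ * d
        ≤⟨ +-monoʳ-≤ (m * (30 * β)) (*-monoʳ-≤ (3 * θ) (few (deg a U (proj₁ stuck)) (proj₁ (proj₂ stuck)))) ⟩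
      m * (30 * β) + 3 * θ * (30 * β) ∎
      where open ≤-Reasoning

    -- Twice the first plus three times the second hypothesis gives `12 β m + 3 ≤ 180 β θ + 90 β`,
    -- but `12 β m ≥ 384 β θ` and `θ ≥ 1`.
    contra : ∀ β θ m S → 3 * S ≤ m * (30 * β) + 3 * θ * (30 * β) → 24 * β * m < 2 * S + 30 * β →
      32 * θ < m → 1 ≤ θ → ⊥
    contra β θ m S h₁ h₂ h₃ h₄ = 1+n≰n (linear {1} {0} (2 + 126 * (β * θ))
      (+-mono-≤ (+-mono-≤ (*-monoʳ-≤ 2 h₁) (*-monoʳ-≤ 3 h₂)) (+-mono-≤ (*-monoʳ-≤ (12 * β) h₃) (*-monoʳ-≤ (78 * β) h₄)))
      (eq β θ m S))
      where
      eq : ∀ β θ m S → 1 + (2 * (m * (30 * β) + 3 * θ * (30 * β)) + 3 * (2 * S + 30 * β) + (12 * β * m + 78 * β * θ)) + (2 + 126 * (β * θ))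
         ≡ 0 + (2 * (3 * S) + 3 * suc (24 * β * m) + (12 * β * suc (32 * θ) + 78 * β * 1))
      eq = solve-∀

-- Walker's strategy

mutual
  -- Visits are never lost, so once `k` is reached Walker may move arbitrarily.
  stayW : ∀ m → Unvisited (c ∷ r) A → length A ≤ m → k ≤ suc (length r) → WW β k B c r
  stayW {c = c} {r = r} {B = B} m π len k≤ with over-or-move B c r
  ... | inj₁ over = end over k≤
  ... | inj₂ (w , leg) with A′ , σ , π′ ← visit leg π with m | ≤-trans (≤-reflexive (sym (↭-length σ))) len
  ... | suc m | s≤s len′ = move (legal⇒¬over leg) w leg (stayB m π′ len′ (m≤n⇒m≤1+n k≤))

  stayB : ∀ m → Unvisited (c ∷ r) A → length A ≤ m → k ≤ suc (length r) → WB β k B c r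
  stayB {c = c} {r = r} {B = B} m π len k≤ with over-or-move B c r
  ... | inj₁ over = end over k≤
  ... | inj₂ (_ , leg) = move (legal⇒¬over leg) λ L _ → stayW m π len k≤

-- Phases are numbered downwards. Phase `0` ends with at most `32 * 32 β = 1024 β` vertices in `U`,
-- the constant in `goal`.
threshold : ℕ → ℕ → ℕ
threshold β zero    = 32 * β
threshold β (suc i) = 2 * threshold β i

-- Bounds the outstanding write-offs, at most `480 β (i + 1)`, by 15 times the threshold, hence by
-- less than half of `U` during phase `i`.
threshold-linear : ∀ β i → 32 * β * suc i ≤ threshold β i
threshold-linear β zero    = ≤-reflexive (*-identityʳ (32 * β))
threshold-linear β (suc i) = linear (32 * β * i) (*-monoʳ-≤ 2 (threshold-linear β i)) (eq β i (threshold β i))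
  where
  eq : ∀ β i t → 32 * β * suc (suc i) + 2 * t + 32 * β * i ≡ 2 * t + 2 * (32 * β * suc i)
  eq = solve-∀

threshold-≥ : ∀ β i → 32 * β ≤ threshold β i
threshold-≥ β i = ≤-trans (m≤m*n (32 * β) (suc i)) (threshold-linear β i)

-- Walker has written off the vertices in Z and still aims to visit those in U.  While
-- |U| exceeds 32 θ for the threshold θ of phase i, she writes off every vertex with at
-- least θ Breaker edges into U; q bounds how often this can still happen in phase i.
record Walking (β i q k : ℕ) {n} (B : List (Edge n)) (c : Fin n) (r Z U : List (Fin n)) : Set where
  field
    partitioned : Unvisited (c ∷ r) (Z ++ U)
    proper      : All IsEdge B
    sparse      : 2 * degSum (mult B) U + deg (mult B) U c ≤ 24 * β * length U
    credit      : 2 * degSum (mult B) U + deg (mult B) U c + 6 * β * length U ≤ 4 * threshold β i * q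
    cap         : q ≤ 480 * β
    room        : deg (mult B) U c + (q + 480 * β * i) < length U
    goal        : k + (q + 480 * β * i + 1024 * β) ≤ suc (length r) + length U

open Walking

isolate : ∀ {Z U U′ : List (Fin n)} {x} → Unvisited p (Z ++ U) → U ↭ x ∷ U′ → Unvisited p (x ∷ Z ++ U′)
isolate {Z = Z} {U′ = U′} π σ = unvisited-↭ (↭-trans (↭-++⁺ˡ Z σ) (shift _ Z U′)) π

unvisited-unique : Unvisited {n} p A → Unique A
unvisited-unique {p = p} π = suffix p (allFin-unique (partition π))
  where
  suffix : ∀ {X : Set} (xs : List X) {ys} → Unique (xs ++ ys) → Unique ys
  suffix []       u       = u
  suffix (x ∷ xs) (_ ∷ u) = suffix xs u

suffix-unvisited : ∀ {Z U : List (Fin n)} → Unvisited p (Z ++ U) → Unvisited (p ++ Z) U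
suffix-unvisited {p = p} {Z} {U} (unvisited π) = unvisited (↭-trans (↭-reflexive (++-assoc p Z U)) π)

finish : ∀ {q} {Z U : List (Fin n)} → Walking β 0 q k B c r Z U → length U ≤ 32 * threshold β 0 → k ≤ suc (length r)
finish {β = β} {k = k} {r = r} {q = q} {U = U} W small =
  linear (q + 480 * β * 0) (+-mono-≤ (goal W) small) (eq β k q (length r) (length U))
  where
  eq : ∀ β k q l m → k + (suc l + m + 32 * (32 * β)) + (q + 480 * β * 0) ≡ suc l + (k + (q + 480 * β * 0 + 1024 * β) + m)
  eq = solve-∀

module _ {β i k : ℕ} {B : List (Edge n)} {c : Fin n} {r Z U : List (Fin n)} where

  nextPhase : ∀ {q} → Walking β (suc i) q k B c r Z U → length U ≤ 32 * threshold β (suc i) →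
    Walking β i (480 * β) k B c r Z U
  nextPhase {q} W small = record
    { partitioned = partitioned W
    ; proper = proper W
    ; sparse = sparse W
    ; credit = linear 0 (+-mono-≤ (sparse W) (*-monoʳ-≤ (30 * β) small))
        (creditEq β (2 * degSum (mult B) U + deg (mult B) U c) (length U) (threshold β i))
    ; cap = ≤-refl
    ; room = linear q (room W) (roomEq β i q (deg (mult B) U c) (length U))
    ; goal = linear q (goal W) (goalEq β i q k (suc (length r)) (length U))
    }
    where
    creditEq : ∀ β t m θ →
      t + 6 * β * m + (24 * β * m + 30 * β * (32 * (2 * θ))) + 0 ≡ 4 * θ * (480 * β) + (t + 30 * β * m)
    creditEq = solve-∀
    roomEq : ∀ β i q d m →
      suc (d + (480 * β + 480 * β * i)) + m + q ≡ m + suc (d + (q + 480 * β * suc i))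
    roomEq = solve-∀
    goalEq : ∀ β i q k l m →
      k + (480 * β + 480 * β * i + 1024 * β) + (l + m) + q ≡ l + m + (k + (q + 480 * β * suc i + 1024 * β))
    goalEq = solve-∀

  -- With `q = 0` the credit would force `6 β |U| = 0`, yet `room` makes `U` nonempty.
  creditLeft : Walking β i 0 k B c r Z U → 1 ≤ β → ⊥
  creditLeft W 1≤β = 1+n≰n (≤-trans positive (≤-trans (credit W) (≤-reflexive (*-zeroʳ (4 * threshold β i)))))
    where
    positive : 1 ≤ 2 * degSum (mult B) U + deg (mult B) U c + 6 * β * length U
    positive = ≤-trans (*-mono-≤ (≤-trans 1≤β (m≤n*m β 6)) (≤-trans (s≤s z≤n) (room W))) (m≤n+m _ _)

  -- Removing `x` lowers `2 S` by at least `4 θ`, the worth of one unit of `q`. Since `θ ≥ 32 β`,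
  -- this outweighs the `24 β` by which the bound in `sparse` shrinks.
  writeOff : ∀ {q x U′} → Walking β i (suc q) k B c r Z U → U ↭ x ∷ U′ → threshold β i ≤ deg (mult B) U x →
    Walking β i q k B c r (x ∷ Z) U′
  writeOff {q} {x} {U′} W σ heavy = record
    { partitioned = isolate (partitioned W) σ
    ; proper = proper W
    ; sparse = linear (mult B c x + 8 * β)
        (+-mono-≤ sparse′ (+-mono-≤ (*-monoʳ-≤ 4 heavy′) (*-monoʳ-≤ 4 (≤-trans (*-monoˡ-≤ β 8≤32) (threshold-≥ β i)))))
        (sparseEq β dx S′ dc (mult B c x) (length U′) (threshold β i))
    ; credit = linear (mult B c x + 6 * β) (+-mono-≤ credit′ (*-monoʳ-≤ 4 heavy′))
        (creditEq β q dx S′ dc (mult B c x) (length U′) (threshold β i))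
    ; cap = <⇒≤ (cap W)
    ; room = linear (mult B c x) room′ (roomEq dc (mult B c x) q (480 * β * i) (length U′))
    ; goal = linear 0 goal′ (goalEq k q (480 * β * i + 1024 * β) (480 * β * i) (1024 * β) (suc (length r)) (length U′))
    }
    where
    dx S′ dc : ℕ
    dx = deg (mult B) U′ x
    S′ = degSum (mult B) U′
    dc = deg (mult B) U′ c

    8≤32 : 8 ≤ 32
    8≤32 = m≤m+n 8 24

    S≡ : degSum (mult B) U ≡ 2 * dx + S′
    S≡ = degSum-remove (mult B) (mult-sym B) (mult-irrefl (proper W)) σ

    d≡ : deg (mult B) U c ≡ mult B c x + dc
    d≡ = deg-↭ (mult B) c σ

    heavy′ : threshold β i ≤ dx
    heavy′ = ≤-trans heavy (≤-reflexive (deg-self (mult B) (mult-sym B) (mult-irrefl (proper W)) σ))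

    sparse′ : 2 * (2 * dx + S′) + (mult B c x + dc) ≤ 24 * β * suc (length U′)
    sparse′ rewrite sym S≡ | sym d≡ | sym (↭-length σ) = sparse W

    credit′ : 2 * (2 * dx + S′) + (mult B c x + dc) + 6 * β * suc (length U′) ≤ 4 * threshold β i * suc q
    credit′ rewrite sym S≡ | sym d≡ | sym (↭-length σ) = credit W

    room′ : mult B c x + dc + (suc q + 480 * β * i) < suc (length U′)
    room′ rewrite sym d≡ | sym (↭-length σ) = room W

    goal′ : k + (suc q + 480 * β * i + 1024 * β) ≤ suc (length r) + suc (length U′)
    goal′ rewrite sym (↭-length σ) = goal W

    sparseEq : ∀ β dx S dc a m θ →
      2 * S + dc + (24 * β * suc m + (4 * dx + 4 * θ)) + (a + 8 * β) ≡
      24 * β * m + (2 * (2 * dx + S) + (a + dc) + (4 * θ + 4 * (8 * β)))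
    sparseEq = solve-∀
    creditEq : ∀ β q dx S dc a m θ →
      2 * S + dc + 6 * β * m + (4 * θ * suc q + 4 * dx) + (a + 6 * β) ≡
      4 * θ * q + (2 * (2 * dx + S) + (a + dc) + 6 * β * suc m + 4 * θ)
    creditEq = solve-∀
    roomEq : ∀ dc a q y m → suc (dc + (q + y)) + suc m + a ≡ m + suc (a + dc + (suc q + y))
    roomEq = solve-∀
    goalEq : ∀ k q t y z l m → k + (q + y + z) + (l + suc m) + 0 ≡ l + m + (k + (suc q + y + z))
    goalEq = solve-∀

  -- `Good` yields `sparse`. In `credit` the term `6 β |U|` prepays Breaker's replies: it falls by
  -- `6 β` as the potential gains at most `6 β`.
  advance : ∀ {q w U′ L} → Walking β i q k B c r Z U → 32 * threshold β i < length U → U ↭ w ∷ U′ →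
    Good (mult B) β (threshold β i) U c w → deg (mult B) U w < threshold β i →
    BreakerLegal β B (w ∷ c ∷ r) L → Walking β i q k (L ++ B) w (c ∷ r) Z U′
  advance {q} {w} {U′} {L} W large σ (free , good) light legal = record
    { partitioned = part
    ; proper = all-++⁺ (All.map proj₁ (proj₁ legal)) (proper W)
    ; sparse = linear 0 (+-mono-≤ (+-mono-≤ (*-monoʳ-≤ 2 S-grow) d-grow) good′)
        (sparseEq β dw S′ dc SL dL (length U′))
    ; credit = linear (3 * dw + dc) (+-mono-≤ (+-mono-≤ (*-monoʳ-≤ 2 S-grow) d-grow) credit′)
        (creditEq β dw S′ dc SL dL (length U′) (4 * threshold β i * q))
    ; cap = cap W
    -- The new degree is below `2 β + θ` and the write-offs are at most `15 θ`, while `U′` has at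
    -- least `32 θ` vertices.
    ; room = linear (15 * threshold β i + (30 * β + 32 * β * i)) (+-mono-≤ (+-mono-≤ d-grow light′)
        (+-mono-≤ (+-mono-≤ (cap W) (*-monoʳ-≤ 16 (threshold-linear β i))) large′))
        (roomEq β i q dw dL (length U′) (threshold β i))
    ; goal = linear 0 goal′ (goalEq k (q + 480 * β * i + 1024 * β) (suc (length r)) (length U′))
    }
    where
    dw S′ dc SL dL : ℕ
    dw = deg (mult B) U′ w
    S′ = degSum (mult B) U′
    dc = deg (mult B) U c
    SL = degSum (mult (L ++ B)) U′
    dL = deg (mult (L ++ B)) U′ w

    part : Unvisited (w ∷ c ∷ r) (Z ++ U′)
    part = unvisited-∷ (isolate (partitioned W) σ) ↭-refl

    U′-unique : Unique U′
    U′-unique = unvisited-unique (suffix-unvisited {Z = Z} part)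

    S≡ : degSum (mult B) U ≡ 2 * dw + S′
    S≡ = degSum-remove (mult B) (mult-sym B) (mult-irrefl (proper W)) σ

    d≡ : deg (mult B) U w ≡ dw
    d≡ = deg-self (mult B) (mult-sym B) (mult-irrefl (proper W)) σ

    L≤ : 2 * length L ≤ 2 * β
    L≤ = *-monoʳ-≤ 2 (breakerLegal-length {p = w ∷ c ∷ r} legal)

    S-grow : SL ≤ 2 * β + S′
    S-grow = ≤-trans (degSum-grow L B U′-unique) (+-monoˡ-≤ S′ L≤)

    d-grow : dL ≤ 2 * β + dw
    d-grow = ≤-trans (deg-grow L B U′-unique w) (+-monoˡ-≤ dw L≤)

    good′ : 2 * (2 * dw + S′) + dc + 30 * β ≤ 24 * β * suc (length U′) + dc + 3 * dw
    good′ rewrite sym S≡ | sym d≡ | sym (↭-length σ) = good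

    credit′ : 2 * (2 * dw + S′) + dc + 6 * β * suc (length U′) ≤ 4 * threshold β i * q
    credit′ rewrite sym S≡ | sym (↭-length σ) = credit W

    light′ : dw < threshold β i
    light′ = subst (_< _) d≡ light

    large′ : 32 * threshold β i < suc (length U′)
    large′ = subst (_ <_) (↭-length σ) large

    goal′ : k + (q + 480 * β * i + 1024 * β) ≤ suc (length r) + suc (length U′)
    goal′ rewrite sym (↭-length σ) = goal W

    sparseEq : ∀ β dw S dc SL dL m →
      2 * SL + dL + (2 * (2 * β + S) + (2 * β + dw) + (24 * β * suc m + dc + 3 * dw)) + 0 ≡
      24 * β * m + (2 * SL + dL + (2 * (2 * dw + S) + dc + 30 * β))
    sparseEq = solve-∀
    creditEq : ∀ β dw S dc SL dL m t →
      2 * SL + dL + 6 * β * m + (2 * (2 * β + S) + (2 * β + dw) + t) + (3 * dw + dc) ≡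
      t + (2 * SL + dL + (2 * (2 * dw + S) + dc + 6 * β * suc m))
    creditEq = solve-∀
    roomEq : ∀ β i q dw dL m θ →
      suc (dL + (q + 480 * β * i)) + (2 * β + dw + θ + (480 * β + 16 * θ + suc m)) + (15 * θ + (30 * β + 32 * β * i)) ≡
      m + (dL + suc dw + (q + 16 * (32 * β * suc i) + suc (32 * θ)))
    roomEq = solve-∀
    goalEq : ∀ k t l m → k + t + (l + suc m) + 0 ≡ suc l + m + (k + t)
    goalEq = solve-∀

-- Lexicographic recursion: a new phase lowers `i`, whereas a write-off, which takes no move, or a
-- visit shrinks `U` and lowers `m`.
walk : ∀ m i {q} {Z U : List (Fin n)} → 1 ≤ β → length U ≤ m → Walking β i q k B c r Z U → WW β k B c r
walk {β = β} m i {U = U} 1≤β len W with length U ≤? 32 * threshold β i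
walk m zero    1≤β len W | yes small = stayW _ (partitioned W) ≤-refl (finish W small)
walk m (suc i) 1≤β len W | yes small = walk m i 1≤β len (nextPhase W small)
walk zero i 1≤β len W | no large = contradiction (≤-trans len z≤n) large
walk {β = β} {B = B} (suc m) i {U = U} 1≤β len W | no large
  with any? (λ x → threshold β i ≤? deg (mult B) U x) U
walk {B = B} (suc m) i {q} {U = U} 1≤β len W | no large | yes heavy
  with x , x∈ , θ≤ ← find heavy with U′ , σ ← extract x∈ with q
... | zero  = ⊥-elim (creditLeft W 1≤β)
... | suc _ = walk m i 1≤β (≤-pred (≤-trans (≤-reflexive (sym (↭-length σ))) len)) (writeOff W σ θ≤)
walk {β = β} {k = k} {B = B} {c = c} {r = r} (suc m) i {q} {Z} {U} 1≤β len W | no large | no none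
  with w , w∈ , good ← choose (mult B) β (threshold β i) U c
         (≤-trans (≤-trans 1≤β (m≤n*m β 32)) (threshold-≥ β i)) (≰⇒> large)
         (≤-trans (s≤s (m≤m+n _ _)) (room W)) (sparse W) (λ x∈ → ≰⇒> λ θ≤ → none (lose x∈ θ≤))
  with U′ , σ ← extract w∈ =
  move (legal⇒¬over legal-w) w legal-w (move (legal⇒¬over (proj₂ further)) λ L legal →
    walk m i 1≤β (≤-pred (≤-trans (≤-reflexive (sym (↭-length σ))) len))
      (advance W (≰⇒> large) σ good light legal))
  where
  legal-w : WalkerLegal B c r w
  legal-w = mult≡0⇒∉B B (proj₁ good) , unvisited-∉ (partitioned W) (∈-++⁺ʳ Z w∈)

  light : deg (mult B) U w < threshold β i
  light = ≰⇒> λ θ≤ → none (lose w∈ θ≤)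

  light′ : deg (mult B) U′ w < length U′
  light′ = begin-strict
    deg (mult B) U′ w       ≡⟨ deg-self (mult B) (mult-sym B) (mult-irrefl (proper W)) σ ⟨
    deg (mult B) U w        <⟨ light ⟩
    threshold β i           ≤⟨ m≤n*m (threshold β i) 32 ⟩
    32 * threshold β i      ≤⟨ ≤-pred (≤-trans (≰⇒> large) (≤-reflexive (↭-length σ))) ⟩
    length U′               ∎
    where open ≤-Reasoning

  -- Breaker's node requires that the game goes on at `w`: being light, `w` has an unclaimed edge
  -- into `U′`.
  further : ∃ (WalkerLegal B w (c ∷ r))
  further with u , u∈ , free ← find-zero (mult B w) U′ light′ =
    u , mult≡0⇒∉B B free , unvisited-∉ (unvisited-∷ (isolate (partitioned W) σ) ↭-refl) (∈-++⁺ʳ Z u∈)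

-- The opening phase and Walker's guarantee

-- The search cannot run out of fuel, because `32 * threshold β i` is at least `i`.
first-phase : ∀ {β x} → 1 ≤ β → ∀ fuel i → x ≤ fuel + i → 32 * threshold β i < x →
  ∃ λ i → 32 * threshold β i < x × x ≤ 32 * threshold β (suc i)
first-phase {β} {x} 1≤β fuel i x≤ lt with x ≤? 32 * threshold β (suc i)
... | yes le = i , lt , le
first-phase {β} {x} 1≤β zero i x≤ lt | no gt = contradiction (≤-trans lt x≤) (≤⇒≯ (begin
  i                     ≤⟨ n≤1+n i ⟩
  suc i                 ≤⟨ m≤n*m (suc i) (32 * β) {{>-nonZero (≤-trans 1≤β (m≤n*m β 32))}} ⟩
  32 * β * suc i        ≤⟨ threshold-linear β i ⟩
  threshold β i         ≤⟨ m≤n*m (threshold β i) 32 ⟩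
  32 * threshold β i    ∎))
  where open ≤-Reasoning
first-phase 1≤β (suc fuel) i x≤ lt | no gt =
  first-phase 1≤β fuel (suc i) (≤-trans x≤ (≤-reflexive (sym (+-suc fuel i)))) (≰⇒> gt)

2^i≤threshold : ∀ {β} → 1 ≤ β → ∀ i → 2 ^ i ≤ threshold β i
2^i≤threshold {β} 1≤β zero    = ≤-trans 1≤β (m≤n*m β 32)
2^i≤threshold     1≤β (suc i) = *-monoʳ-≤ 2 (2^i≤threshold 1≤β i)

deg-[] : ∀ (U : List (Fin n)) x → deg (mult []) U x ≡ 0
deg-[] U x = trans (sum-map-const 0 U) (*-zeroʳ (length U))

degSum-[] : ∀ (U : List (Fin n)) → degSum (mult []) U ≡ 0
degSum-[] U = trans (cong sum (map-cong (deg-[] U) U)) (trans (sum-map-const 0 U) (*-zeroʳ (length U)))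

-- `480 β` write-offs for each of the phases `0` to `i`, and `1024 β` vertices left over at the end.
loss : ℕ → ℕ → ℕ
loss β i = 480 * β + 480 * β * i + 1024 * β

walker-bound : 1 ≤ β → 2 + 32 * threshold β 0 ≤ n → (v : Fin n) → ∃ λ i → 2 ^ i ≤ n × WW β (n ∸ loss β i) [] v []
walker-bound {β} {n} 1≤β N≤n v = start (unvisited-start v)
  where
  start : (∃ λ A → Unvisited (v ∷ []) A) → ∃ λ i → 2 ^ i ≤ n × WW β (n ∸ loss β i) [] v []
  start (A , π) = i , ≤-trans (2^i≤threshold 1≤β i) (≤-trans (m≤n*m _ 32) (≤-trans (<⇒≤ lt) A≤n)) , result (loss β i ≤? n)
    where
    A≤n : length A ≤ n
    A≤n = ≤-trans (n≤1+n _) (≤-reflexive (unvisited-length π))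

    large : 32 * threshold β 0 < length A
    large = ≤-pred (≤-trans N≤n (≤-reflexive (sym (unvisited-length π))))

    phase = first-phase 1≤β (length A) 0 (m≤m+n _ 0) large
    i = proj₁ phase
    lt = proj₁ (proj₂ phase)

    start-W : loss β i ≤ n → Walking β i (480 * β) (n ∸ loss β i) [] v [] [] A
    start-W loss≤n = record
      { partitioned = π
      ; proper = []
      ; sparse = ≤-trans (≤-reflexive Ψ≡0) z≤n
      -- Initially only the prepayment counts: `6 β |U| ≤ 6 β * 64 θ`, well below `4 θ * 480 β`.
      ; credit = ≤-trans (≤-reflexive (cong (_+ 6 * β * length A) Ψ≡0))
          (linear (1536 * (β * threshold β i)) (*-monoʳ-≤ (6 * β) (proj₂ (proj₂ phase))) (creditEq β (length A) (threshold β i)))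
      ; cap = ≤-refl
      ; room = subst (λ d → d + (480 * β + 480 * β * i) < length A) (sym (deg-[] A v))
          (linear (17 * threshold β i) (+-mono-≤ (*-monoʳ-≤ 15 (threshold-linear β i)) lt) (roomEq β i (threshold β i) (length A)))
      ; goal = ≤-reflexive (trans (m∸n+n≡m loss≤n) (sym (unvisited-length π)))
      }
      where
      Ψ≡0 : 2 * degSum (mult []) A + deg (mult []) A v ≡ 0
      Ψ≡0 = cong₂ (λ s d → 2 * s + d) (degSum-[] A) (deg-[] A v)

      creditEq : ∀ β m θ → 6 * β * m + 6 * β * (32 * (2 * θ)) + 1536 * (β * θ) ≡ 4 * θ * (480 * β) + 6 * β * m
      creditEq = solve-∀

      roomEq : ∀ β i θ m →
        suc (480 * β + 480 * β * i) + (15 * θ + m) + 17 * θ ≡ m + (15 * (32 * β * suc i) + suc (32 * θ))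
      roomEq = solve-∀

    result : Dec (loss β i ≤ n) → WW β (n ∸ loss β i) [] v []
    result (yes loss≤n) = walk _ i 1≤β ≤-refl (start-W loss≤n)
    -- Here the truncated difference is 0, so nothing has to be achieved.
    result (no loss≰n)  = stayW _ π ≤-refl (≤-trans (≤-reflexive (m≤n⇒m∸n≡0 (≰⇒≥ loss≰n))) z≤n)

-- Logarithms and the final estimate

2^⌊log₂⌋≤ : ∀ n → 1 ≤ n → 2 ^ ⌊log₂ n ⌋ ≤ n
2^⌊log₂⌋≤ = <-rec _ step
  where
  step : ∀ n → (∀ {m} → m < n → 1 ≤ m → 2 ^ ⌊log₂ m ⌋ ≤ m) → 1 ≤ n → 2 ^ ⌊log₂ n ⌋ ≤ n
  step 1 rec _ = ≤-refl
  step n@(suc (suc m)) rec _ = double ⌊log₂ n ⌋ (⌊log₂⌊n/2⌋⌋≡⌊log₂n⌋∸1 n)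
    where
    open ≤-Reasoning
    double : ∀ l → ⌊log₂ ⌊ n /2⌋ ⌋ ≡ l ∸ 1 → 2 ^ l ≤ n
    double zero    _  = s≤s z≤n
    double (suc l) eq = begin
      2 * 2 ^ l                       ≡⟨ cong (λ t → 2 * 2 ^ t) eq ⟨
      2 * 2 ^ ⌊log₂ ⌊ n /2⌋ ⌋         ≤⟨ *-monoʳ-≤ 2 (rec (⌊n/2⌋<n (suc m)) (s≤s z≤n)) ⟩
      2 * ⌊ n /2⌋                     ≤⟨ +-monoʳ-≤ ⌊ n /2⌋ (≤-trans (≤-reflexive (+-identityʳ _)) (⌊n/2⌋≤⌈n/2⌉ n)) ⟩
      ⌊ n /2⌋ + ⌈ n /2⌉               ≡⟨ ⌊n/2⌋+⌈n/2⌉≡n n ⟩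
      n                               ∎

-- The closed form lets Breaker protect `⌊log₂ n⌋ ∸ 2` vertices.
reserve-2^ : ∀ j → 4 + reserve j ≡ 2 ^ (2 + j)
reserve-2^ zero    = refl
reserve-2^ (suc j) = trans (eq (reserve j)) (cong (2 *_) (reserve-2^ j))
  where
  eq : ∀ h → 4 + (4 + 2 * h) ≡ 2 * (4 + h)
  eq = solve-∀

theorem2 : (β : ℕ) → 2 ≤ β →
    ∃[ a ] ∃[ b ] (1 ≤ a × 1 ≤ b × ∃[ N ] ((n : ℕ) → N ≤ n → (v0 : Fin n) →
    ∃[ s ] (s ≤ n × GameValue β n v0 (n ∸ s) ×
    ⌊log₂ n ⌋ ≤ a * s × s ≤ b * ⌊log₂ n ⌋)))
-- The factor 3 comes from `2 + j ≤ 3 * j` for `j = ⌊log₂ n⌋ ∸ 2 ≥ 1`. The other is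
-- `1984 = 480 + 480 + 1024`, the constant part of `loss` being absorbed by `1 ≤ ⌊log₂ n⌋`.
theorem2 β 2≤β = 3 , 1984 * β , s≤s z≤n , ≤-trans 1≤β (m≤n*m β 1984) , 2 + 32 * threshold β 0 , main
  where
  1≤β : 1 ≤ β
  1≤β = ≤-trans (s≤s z≤n) 2≤β

  main : ∀ n → 2 + 32 * threshold β 0 ≤ n → (v0 : Fin n) →
    ∃[ s ] (s ≤ n × GameValue β n v0 (n ∸ s) × ⌊log₂ n ⌋ ≤ 3 * s × s ≤ 1984 * β * ⌊log₂ n ⌋)
  main n N≤n v0 =
    n ∸ v , m∸n≤m n v , subst (GameValue β n v0) (sym (m∸[m∸n]≡n v≤n)) (ww , bw) , lower , upper
    where
    value : ∃ λ v → GameValue β n v0 v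
    value = valueW _ (proj₂ (unvisited-start v0)) ≤-refl

    walker : ∃ λ i → 2 ^ i ≤ n × WW β (n ∸ loss β i) [] v0 []
    walker = walker-bound 1≤β N≤n v0

    v = proj₁ value
    ww = proj₁ (proj₂ value)
    bw = proj₂ (proj₂ value)
    i = proj₁ walker

    8≤n : 8 ≤ n
    8≤n = ≤-trans (≤-trans (m≤m+n 8 1018) (+-monoʳ-≤ 2 (*-monoʳ-≤ 32 (*-monoʳ-≤ 32 1≤β)))) N≤n

    3≤log : 3 ≤ ⌊log₂ n ⌋
    3≤log = ≤-trans (≤-reflexive (sym (⌊log₂[2^n]⌋≡n 3))) (⌊log₂⌋-mono-≤ 8≤n)

    j = ⌊log₂ n ⌋ ∸ 2

    2+j : 2 + j ≡ ⌊log₂ n ⌋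
    2+j = m+[n∸m]≡n (≤-trans (n≤1+n 2) 3≤log)

    reserve≤n : 4 + reserve j ≤ n
    reserve≤n = ≤-trans (≤-reflexive (trans (reserve-2^ j) (cong (2 ^_) 2+j)))
      (2^⌊log₂⌋≤ n (≤-trans (s≤s z≤n) 8≤n))

    j≤n : j ≤ n
    j≤n = ≤-trans (≤-trans (m≤n*m j 2) (2j≤reserve j)) (≤-trans (m≤n+m _ 4) reserve≤n)

    v≤ : v ≤ n ∸ j
    v≤ = WW≤BW ww (breaker-bound j 2≤β (≤-trans (m≤m+n 3 5) 8≤n) (≤-trans (+-monoˡ-≤ (reserve j) (m≤m+n 2 2)) reserve≤n) v0)

    v≤n : v ≤ n
    v≤n = ≤-trans v≤ (m∸n≤m n j)

    lower : ⌊log₂ n ⌋ ≤ 3 * (n ∸ v)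
    lower = begin
      ⌊log₂ n ⌋     ≡⟨ 2+j ⟨
      2 + j         ≤⟨ linear 0 (*-monoʳ-≤ 2 (m+n≤o⇒m≤o∸n 1 3≤log)) (eq j) ⟩
      3 * j         ≤⟨ *-monoʳ-≤ 3 (≤-trans (≤-reflexive (sym (m∸[m∸n]≡n j≤n))) (∸-monoʳ-≤ n v≤)) ⟩
      3 * (n ∸ v)   ∎
      where
      open ≤-Reasoning
      eq : ∀ j → 2 + j + 2 * j + 0 ≡ 3 * j + 2 * 1
      eq = solve-∀

    i≤log : i ≤ ⌊log₂ n ⌋
    i≤log = ≤-trans (≤-reflexive (sym (⌊log₂[2^n]⌋≡n i))) (⌊log₂⌋-mono-≤ (proj₁ (proj₂ walker)))

    upper : n ∸ v ≤ 1984 * β * ⌊log₂ n ⌋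
    upper = begin
      n ∸ v                        ≤⟨ m≤n+o⇒m∸n≤o n v n≤v+loss ⟩
      loss β i                     ≤⟨ linear 0 (+-mono-≤ (*-monoʳ-≤ (480 * β) i≤log)
                                        (*-monoʳ-≤ (1504 * β) (≤-trans (s≤s z≤n) 3≤log))) (eq β i ⌊log₂ n ⌋) ⟩
      1984 * β * ⌊log₂ n ⌋         ∎
      where
      open ≤-Reasoning
      n≤v+loss : n ≤ v + loss β i
      n≤v+loss = ≤-trans (m≤n+m∸n n (loss β i))
        (≤-trans (+-monoʳ-≤ (loss β i) (WW≤BW (proj₂ (proj₂ walker)) bw)) (≤-reflexive (+-comm (loss β i) v)))
      eq : ∀ β i l → 480 * β + 480 * β * i + 1024 * β + (480 * β * l + 1504 * β * l) + 0 ≡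
        1984 * β * l + (480 * β * i + 1504 * β * 1)
      eq = solve-∀
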